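{- Let $n,k \in \mathbb{N}$ with $n \geqslant 13k - 15$. Then $m(n,3,2,k) = n - k + 1$.
   Context: An $r$-colouring of the complete graph $K_n$ ($n \geqslant 2$) is any function $f: E(K_n) \to [r] = \{1,\dots,r\}$. For a subgraph $H \subseteq K_n$, $c_f(H) = |f(E(H))|$ is the number of distinct colours on edges of $H$. A graph on at least $k+1$ vertices is $k$-connected if deleting any at most $k-1$ vertices leaves a connected graph. $M(f,n,r,s,k)$ is the maximum number of vertices of a $k$-connected subgraph $H \subseteq K_n$ with $c_f(H) \leqslant s$ (taken to be $0$ if no such subgraph exists), and $m(n,r,s,k) = \min_f M(f,n,r,s,k)$, the minimum over all $r$-colourings $f$ of $E(K_n)$. -}

module Defs where

open import Data.Nat using (ℕ; zero; suc; _≤_; _<_; _∸_; _+_)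
open import Data.Fin using (Fin; zero; suc)
open import Data.Fin.Properties using (_≟_)
open import Data.Fin.Subset using (Subset; _∈_; _∩_; ∁; ∣_∣)
open import Data.Bool using (Bool; true; false; _∨_; _∧_)
open import Data.Vec using (tabulate)
open import Data.Product using (Σ; ∃; _×_)
open import Data.Sum using (_⊎_)
open import Relation.Nullary using (¬_)
open import Relation.Nullary.Decidable using (⌊_⌋)
open import Relation.Binary.PropositionalEquality using (_≡_)

anyFin : ∀ {n} → (Fin n → Bool) → Bool
anyFin {zero} p = false
anyFin {suc n} p = p zero ∨ anyFin (λ i → p (suc i))

-- An r-colouring of the edges of K_n (vertex set Fin n).  An edge {u,v}
-- (u ≢ v) gets colour col u v = col v u; values on the diagonal are
-- irrelevant since K_n has no loops.
record Colouring (n r : ℕ) : Set where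
  field
    col : Fin n → Fin n → Fin r
    sym : ∀ u v → col u v ≡ col v u
open Colouring public

record Subgraph (n : ℕ) : Set where
  field
    V   : Subset n
    E   : Fin n → Fin n → Bool
    E-sym   : ∀ u v → E u v ≡ E v u
    E-valid : ∀ u v → E u v ≡ true → (u ∈ V) × (v ∈ V) × ¬ (u ≡ v)
open Subgraph public

usedColours : ∀ {n r} → Colouring n r → Subgraph n → Subset r
usedColours f H =
  tabulate (λ c → anyFin (λ u → anyFin (λ v → E H u v ∧ ⌊ col f u v ≟ c ⌋)))

cf : ∀ {n r} → Colouring n r → Subgraph n → ℕ
cf f H = ∣ usedColours f H ∣

-- Walks in H using only vertices of W (the start vertex u is assumed in W
-- by the caller).
data Reach {n : ℕ} (H : Subgraph n) (W : Subset n) : Fin n → Fin n → Set where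
  here : ∀ {u} → Reach H W u u
  step : ∀ {u v w} → E H u v ≡ true → v ∈ W → Reach H W v w → Reach H W u w

ConnectedOn : ∀ {n} → Subgraph n → Subset n → Set
ConnectedOn H W = ∀ u v → u ∈ W → v ∈ W → Reach H W u v

KConnected : ∀ {n} → ℕ → Subgraph n → Set
KConnected k H =
  (suc k ≤ ∣ V H ∣) ×
  (∀ (D : Subset _) → ∣ D ∣ < k → ConnectedOn H (V H ∩ ∁ D))

Admissible : ∀ {n r} → Colouring n r → ℕ → ℕ → Subgraph n → Set
Admissible f s k H = KConnected k H × (cf f H ≤ s)

-- M(f,n,r,s,k) ≥ v  (M is 0 when no admissible subgraph exists)
M≥ : ∀ {n r} → Colouring n r → ℕ → ℕ → ℕ → Set
M≥ {n} f s k v = (v ≡ 0) ⊎ Σ (Subgraph n) (λ H → Admissible f s k H × (v ≤ ∣ V H ∣))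

M≤ : ∀ {n r} → Colouring n r → ℕ → ℕ → ℕ → Set
M≤ {n} f s k v = ∀ (H : Subgraph n) → Admissible f s k H → ∣ V H ∣ ≤ v

-- m(n,r,s,k) = v, where m(n,r,s,k) = min over f of M(f,n,r,s,k).
m≡ : ℕ → ℕ → ℕ → ℕ → ℕ → Set
m≡ n r s k v =
  (∀ (f : Colouring n r) → M≥ f s k v) × (∃ λ (f : Colouring n r) → M≤ f s k v)

{-# OPTIONS --safe #-}
module Submission where

-- Write k = j + 1.
--
-- Upper bound: take disjoint sets A₀, A₁, A₂ of j vertices and give colour i to
-- the edges from Aᵢ to Aᵢ₊₁ (cyclically), to those inside Aᵢ and to those
-- leaving A₀ ∪ A₁ ∪ A₂.  A vertex of Aᵢ then meets edges of colours other than
-- i only towards Aᵢ₋₁, so it has fewer than k neighbours in any graph avoiding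
-- colour i, and a k-connected graph avoiding colour i misses all of Aᵢ.
--
-- Lower bound: fix a colour c and peel off a set R, keeping the invariant that
-- each of its vertices sends at most j edges of colours other than c to the
-- complement of R.  While ∣R∣ ≤ j, either the two other colours are k-connected
-- on ∁ R, or some D with ∣D∣ ≤ j separates ∁ R into parts A and B, and all edges
-- between A and B have colour c.  If ∣A∣, ∣B∣ > j, then colour c alone is
-- k-connected on ∁ D; otherwise the smaller part joins R.  If no subgraph is
-- found, every colour i yields a set Rᵢ with j < ∣Rᵢ∣ ≤ 2j.  These are disjoint
-- since n > 6j.  An edge between Rᵢ and Rₗ differs in colour from i or from l,
-- so the invariant gives
--   ∣R₀∣∣R₁∣ + ∣R₁∣∣R₂∣ + ∣R₂∣∣R₀∣ ≤ j (∣R₀∣ + ∣R₁∣ + ∣R₂∣),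
-- contradicting ∣Rᵢ∣ > j.

open import Defs
open import Data.Bool using (Bool; true; false; if_then_else_; _∧_)
open import Data.Bool.Properties using (∨-zeroʳ)
import Data.Bool.Properties as Bool
open import Data.Fin using (Fin; zero; suc; inject₁)
open import Data.Fin.Patterns using (0F; 1F; 2F; 3F)
open import Data.Fin.Properties using (_≟_; all?; any?)
open import Data.Fin.Subset using (Subset; _∈_; _∉_; _⊆_; _⊃_; _∩_; _∪_; ∁; ∣_∣; ⊤; ⊥; ⁅_⁆; Nonempty; inside; outside)
open import Data.Fin.Subset.Induction using (Acc; acc; ⊃-wellFounded)
open import Data.Fin.Subset.Properties
open import Data.Nat using (ℕ; zero; suc; _≤_; _<_; _+_; _∸_; _*_; z≤n; s≤s; s≤s⁻¹; _≤?_)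
open import Data.Nat.Properties hiding (_≟_)
open import Data.Nat.Solver using (module +-*-Solver)
open import Data.Product using (∃; ∃₂; _×_; _,_; proj₁; proj₂)
open import Data.Sum using (_⊎_; inj₁; inj₂)
open import Data.Vec using (Vec; []; _∷_; here; there; lookup; tabulate; map; replicate; _++_)
open import Data.Vec.Properties using (lookup∘tabulate; []=⇒lookup; lookup⇒[]=; lookup-map; map-++; map-replicate)
open import Function using (_∘_; mk⇔)
open import Relation.Binary.PropositionalEquality using (_≡_; _≢_; refl; trans; cong; cong₂; subst) renaming (sym to ≡-sym)
open import Relation.Nullary using (¬_; Dec; yes; no; does; contradiction; ¬?)
open import Relation.Nullary.Decidable using (_×-dec_; _→-dec_; dec-true; does-⇔; isYes; decidable-stable)
open import Algebra.Properties.Semiring.Sum +-*-semiring using (sum; ∑-distrib-+; ∑-comm; *-distribˡ-sum; *-distribʳ-sum; sum-cong-≗)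

private
  variable
    m n j : ℕ

does⁻ : ∀ {a} {A : Set a} (a? : Dec A) → does a? ≡ true → A
does⁻ (yes a) _ = a

-- Cardinalities of subsets

∈-tabulate⁺ : (p : Fin n → Bool) {x : Fin n} → p x ≡ true → x ∈ tabulate p
∈-tabulate⁺ p {x} px = lookup⇒[]= x _ (trans (lookup∘tabulate p x) px)

∈-tabulate⁻ : (p : Fin n → Bool) {x : Fin n} → x ∈ tabulate p → p x ≡ true
∈-tabulate⁻ p {x} x∈ = trans (≡-sym (lookup∘tabulate p x)) ([]=⇒lookup x∈)

∣p∪q∣≤∣p∣+∣q∣ : (p q : Subset n) → ∣ p ∪ q ∣ ≤ ∣ p ∣ + ∣ q ∣
∣p∪q∣≤∣p∣+∣q∣ []            []            = z≤n
∣p∪q∣≤∣p∣+∣q∣ (inside  ∷ p) (t       ∷ q) = s≤s (≤-trans (∣p∪q∣≤∣p∣+∣q∣ p q) (+-monoʳ-≤ ∣ p ∣ (∣p∣≤∣x∷p∣ t q)))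
∣p∪q∣≤∣p∣+∣q∣ (outside ∷ p) (inside  ∷ q) = ≤-trans (s≤s (∣p∪q∣≤∣p∣+∣q∣ p q)) (≤-reflexive (≡-sym (+-suc ∣ p ∣ ∣ q ∣)))
∣p∪q∣≤∣p∣+∣q∣ (outside ∷ p) (outside ∷ q) = ∣p∪q∣≤∣p∣+∣q∣ p q

Disjoint : Subset n → Subset n → Set
Disjoint p q = ∀ {x} → x ∈ p → x ∉ q

disjoint⇒∣p∣+∣q∣≤∣p∪q∣ : (p q : Subset n) → Disjoint p q → ∣ p ∣ + ∣ q ∣ ≤ ∣ p ∪ q ∣
disjoint⇒∣p∣+∣q∣≤∣p∪q∣ []            []            _   = z≤n
disjoint⇒∣p∣+∣q∣≤∣p∪q∣ (inside  ∷ p) (inside  ∷ q) p∥q = contradiction here (p∥q here)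
disjoint⇒∣p∣+∣q∣≤∣p∪q∣ (inside  ∷ p) (outside ∷ q) p∥q = s≤s (disjoint⇒∣p∣+∣q∣≤∣p∪q∣ p q λ x∈p x∈q → p∥q (there x∈p) (there x∈q))
disjoint⇒∣p∣+∣q∣≤∣p∪q∣ (outside ∷ p) (inside  ∷ q) p∥q = ≤-trans (≤-reflexive (+-suc ∣ p ∣ ∣ q ∣)) (s≤s (disjoint⇒∣p∣+∣q∣≤∣p∪q∣ p q λ x∈p x∈q → p∥q (there x∈p) (there x∈q)))
disjoint⇒∣p∣+∣q∣≤∣p∪q∣ (outside ∷ p) (outside ∷ q) p∥q = disjoint⇒∣p∣+∣q∣≤∣p∪q∣ p q λ x∈p x∈q → p∥q (there x∈p) (there x∈q)

-- Otherwise `q ⊆ p`. This pigeonhole supplies the missing colour and every vertex chosen to avoid a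
-- small set.
∣p∣<∣q∣⇒∃ : (p q : Subset n) → ∣ p ∣ < ∣ q ∣ → ∃ λ x → x ∈ q × x ∉ p
∣p∣<∣q∣⇒∃ p q ∣p∣<∣q∣ with any? (λ x → (x ∈? q) ×-dec ¬? (x ∈? p))
... | yes ∃x = ∃x
... | no ¬∃x = contradiction (p⊆q⇒∣p∣≤∣q∣ q⊆p) (<⇒≱ ∣p∣<∣q∣)
  where
  q⊆p : q ⊆ p
  q⊆p {x} x∈q = decidable-stable (x ∈? p) λ x∉p → ¬∃x (x , x∈q , x∉p)

∣p∣≤m⇒n∸m≤∣∁p∣ : (p : Subset n) → ∣ p ∣ ≤ m → n ∸ m ≤ ∣ ∁ p ∣
∣p∣≤m⇒n∸m≤∣∁p∣ {n} p ∣p∣≤m = ≤-trans (∸-monoʳ-≤ n ∣p∣≤m) (≤-reflexive (≡-sym (∣∁p∣≡n∸∣p∣ p)))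

∣p++q∣≡∣p∣+∣q∣ : (p : Subset m) (q : Subset n) → ∣ p ++ q ∣ ≡ ∣ p ∣ + ∣ q ∣
∣p++q∣≡∣p∣+∣q∣ []            q = refl
∣p++q∣≡∣p∣+∣q∣ (inside  ∷ p) q = cong suc (∣p++q∣≡∣p∣+∣q∣ p q)
∣p++q∣≡∣p∣+∣q∣ (outside ∷ p) q = ∣p++q∣≡∣p∣+∣q∣ p q

-- Turns cardinalities into sums, so that the double count between layers can exchange the order of
-- summation.
indicator : Subset n → Fin n → ℕ
indicator p x = if lookup p x then 1 else 0

∣p∣≡∑indicator : (p : Subset n) → ∣ p ∣ ≡ sum (indicator p)
∣p∣≡∑indicator []            = refl
∣p∣≡∑indicator (inside  ∷ p) = cong suc (∣p∣≡∑indicator p)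
∣p∣≡∑indicator (outside ∷ p) = ∣p∣≡∑indicator p

indicator-∈ : (p : Subset n) {x : Fin n} → x ∈ p → indicator p x ≡ 1
indicator-∈ p x∈p = cong (λ b → if b then 1 else 0) ([]=⇒lookup x∈p)

indicator-∉ : (p : Subset n) {x : Fin n} → x ∉ p → indicator p x ≡ 0
indicator-∉ p {x} x∉p with lookup p x in eq
... | true  = contradiction (lookup⇒[]= x p eq) x∉p
... | false = refl

∑-mono-≤ : (g h : Fin n → ℕ) → (∀ x → g x ≤ h x) → sum g ≤ sum h
∑-mono-≤ {zero}  g h g≤h = z≤n
∑-mono-≤ {suc n} g h g≤h = +-mono-≤ (g≤h zero) (∑-mono-≤ (g ∘ suc) (h ∘ suc) (g≤h ∘ suc))

-- Colours used by a subgraph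

anyFin⁺ : (p : Fin n → Bool) (x : Fin n) → p x ≡ true → anyFin p ≡ true
anyFin⁺ p zero    px rewrite px = refl
anyFin⁺ p (suc x) px rewrite anyFin⁺ (p ∘ suc) x px = ∨-zeroʳ (p zero)

anyFin⁻ : (p : Fin n → Bool) → anyFin p ≡ true → ∃ λ x → p x ≡ true
anyFin⁻ {suc n} p eq with p zero in eq₀
... | true  = zero , eq₀
... | false with anyFin⁻ (p ∘ suc) eq
...   | x , px = suc x , px

module _ {r : ℕ} (f : Colouring n r) (H : Subgraph n) where

  usedColours⁺ : ∀ u v → E H u v ≡ true → col f u v ∈ usedColours f H
  usedColours⁺ u v uv = ∈-tabulate⁺ _ (anyFin⁺ _ u (anyFin⁺ _ v eq))
    where
    eq : E H u v ∧ isYes (col f u v ≟ col f u v) ≡ true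
    eq rewrite uv with col f u v ≟ col f u v
    ... | yes _ = refl
    ... | no ≢  = contradiction refl ≢

  usedColours⁻ : ∀ {c} → c ∈ usedColours f H → ∃₂ λ u v → E H u v ≡ true × col f u v ≡ c
  usedColours⁻ {c} c∈ with anyFin⁻ _ (∈-tabulate⁻ (λ c → anyFin λ u → anyFin λ v → E H u v ∧ isYes (col f u v ≟ c)) c∈)
  ... | u , eq with anyFin⁻ _ eq
  ...   | v , eq′ with E H u v in uv | col f u v ≟ c
  ...     | true | yes col≡c = u , v , uv , col≡c

missingColour : (C : Subset 3) → ∣ C ∣ ≤ 2 → ∃ λ c → c ∉ C
missingColour C ∣C∣≤2 with ∣p∣<∣q∣⇒∃ C ⊤ (s≤s ∣C∣≤2)
... | c , _ , c∉C = c , c∉C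

-- Subgraphs spanned by a set of colours

module _ {r : ℕ} (f : Colouring n r) (C : Subset r) (W : Subset n) where

  -- The clause `u ≢ v` excludes loops, since the diagonal values of `col` are arbitrary.
  Joined : Fin n → Fin n → Set
  Joined u v = u ∈ W × v ∈ W × u ≢ v × col f u v ∈ C

  joined? : ∀ u v → Dec (Joined u v)
  joined? u v = (u ∈? W) ×-dec (v ∈? W) ×-dec ¬? (u ≟ v) ×-dec (col f u v ∈? C)

  joined-sym : ∀ {u v} → Joined u v → Joined v u
  joined-sym {u} {v} (u∈ , v∈ , u≢v , uv∈C) = v∈ , u∈ , u≢v ∘ ≡-sym , subst (_∈ C) (sym f u v) uv∈C

  coloured : Subgraph n
  coloured = record
    { V       = W
    ; E       = λ u v → does (joined? u v)
    ; E-sym   = λ u v → does-⇔ (mk⇔ joined-sym joined-sym) (joined? u v) (joined? v u)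
    ; E-valid = λ u v uv → let u∈ , v∈ , u≢v , _ = does⁻ (joined? u v) uv in u∈ , v∈ , u≢v
    }

  coloured⁺ : ∀ {u v} → Joined u v → E coloured u v ≡ true
  coloured⁺ {u} {v} = dec-true (joined? u v)

  cf-coloured : cf f coloured ≤ ∣ C ∣
  cf-coloured = p⊆q⇒∣p∣≤∣q∣ used⊆C
    where
    used⊆C : usedColours f coloured ⊆ C
    used⊆C c∈ with usedColours⁻ f coloured c∈
    ... | u , v , uv , refl = proj₂ (proj₂ (proj₂ (does⁻ (joined? u v) uv)))

-- Walks

module _ {H : Subgraph n} {W : Subset n} where

  Reach-trans : ∀ {u v w} → Reach H W u v → Reach H W v w → Reach H W u w
  Reach-trans here           r = r
  Reach-trans (step uv v∈ s) r = step uv v∈ (Reach-trans s r)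

  Reach-sym : ∀ {u v} → u ∈ W → Reach H W u v → Reach H W v u
  Reach-sym u∈ here                           = here
  Reach-sym u∈ (step {u = u} {v = v} uv v∈ r) =
    Reach-trans (Reach-sym v∈ r) (step (trans (E-sym H v u) uv) u∈ here)

Closed : Subgraph n → Subset n → Subset n → Set
Closed H W S = ∀ {x y} → x ∈ S → y ∈ W → y ∉ S → E H x y ≢ true

module _ (H : Subgraph n) (W : Subset n) {u v : Fin n} where

  private
    -- Graph search from `u`: `S` holds the vertices reached so far. An edge leaving `S` inside `W`
    -- adds its far end, a strict growth that `Acc _⊃_` tracks. When no such edge is left, `S`
    -- either contains `v` or is the closed set separating it from `u`.
    grow : (S : Subset n) → Acc _⊃_ S → u ∈ S → (∀ {x} → x ∈ S → Reach H W u x) →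
           Reach H W u v ⊎ ∃ λ T → u ∈ T × v ∉ T × Closed H W T
    grow S (acc rec) u∈S reach
      with any? (λ x → any? λ y → (x ∈? S) ×-dec (y ∈? W) ×-dec ¬? (y ∈? S) ×-dec (E H x y Bool.≟ true))
    ... | yes (x , y , x∈S , y∈W , y∉S , xy) =
      grow (S ∪ ⁅ y ⁆) (rec (p⊆p∪q ⁅ y ⁆ , y , x∈p∪q⁺ (inj₂ (x∈⁅x⁆ y)) , y∉S)) (p⊆p∪q ⁅ y ⁆ u∈S) reach′
      where
      reach′ : ∀ {z} → z ∈ S ∪ ⁅ y ⁆ → Reach H W u z
      reach′ z∈ with x∈p∪q⁻ S ⁅ y ⁆ z∈
      ... | inj₁ z∈S = reach z∈S
      ... | inj₂ z∈y rewrite x∈⁅y⁆⇒x≡y y z∈y = Reach-trans (reach x∈S) (step xy y∈W here)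
    ... | no ¬∃ with v ∈? S
    ...   | yes v∈S = inj₁ (reach v∈S)
    ...   | no v∉S  = inj₂ (S , u∈S , v∉S , λ {x} {y} x∈S y∈W y∉S xy → ¬∃ (x , y , x∈S , y∈W , y∉S , xy))

  reach-or-closed : Reach H W u v ⊎ ∃ λ S → u ∈ S × v ∉ S × Closed H W S
  reach-or-closed = grow ⁅ u ⁆ (⊃-wellFounded _) (x∈⁅x⁆ u) reach
    where
    reach : ∀ {x} → x ∈ ⁅ u ⁆ → Reach H W u x
    reach x∈u rewrite x∈⁅y⁆⇒x≡y u x∈u = here

-- Lower bound

module _ (f : Colouring n 3) (j : ℕ) where

  -- Off-colour neighbourhoods and peeled sets

  otherColours : Fin 3 → Fin n → Subset n
  otherColours c x = tabulate λ y → does (¬? (col f x y ≟ c))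

  otherColours⁺ : ∀ {c x y} → col f x y ≢ c → y ∈ otherColours c x
  otherColours⁺ {c} {x} {y} xy≢c = ∈-tabulate⁺ _ (dec-true (¬? (col f x y ≟ c)) xy≢c)

  otherColours⁻ : ∀ {c x y} → y ∈ otherColours c x → col f x y ≢ c
  otherColours⁻ {c} {x} {y} y∈ = does⁻ (¬? (col f x y ≟ c)) (∈-tabulate⁻ (λ y → does (¬? (col f x y ≟ c))) y∈)

  -- Only neighbours outside `R` are counted, so the bound for a vertex already peeled survives
  -- every enlargement of `R`.
  Peeled : Fin 3 → Subset n → Set
  Peeled c R = ∀ {x} → x ∈ R → ∣ ∁ R ∩ otherColours c x ∣ ≤ j

  -- The upper bound on the size makes layers of different colours disjoint; the lower bound drives
  -- the final double count.
  Layer : Fin 3 → Set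
  Layer c = ∃ λ S → Peeled c S × j < ∣ S ∣ × ∣ S ∣ ≤ j + j

  -- For a vertex of `R` the complement has only shrunk. For a vertex of `P`, an edge leaving
  -- `R ∪ P` in another colour than `c` must end in `D`, which has at most `j` elements.
  peeled-∪ : ∀ {c R D P} → Peeled c R → ∣ D ∣ ≤ j →
             (∀ {x y} → x ∈ P → y ∉ R → y ∉ D → y ∉ P → col f x y ≡ c) → Peeled c (R ∪ P)
  peeled-∪ {c} {R} {D} {P} peeled ∣D∣≤j sep {x} x∈ with x∈p∪q⁻ R P x∈
  ... | inj₁ x∈R = ≤-trans (p⊆q⇒∣p∣≤∣q∣ shrink) (peeled x∈R)
    where
    shrink : ∁ (R ∪ P) ∩ otherColours c x ⊆ ∁ R ∩ otherColours c x
    shrink y∈ with x∈p∩q⁻ _ _ y∈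
    ... | y∈∁ , y∈o = x∈p∩q⁺ (p⊆q⇒∁p⊇∁q (p⊆p∪q P) y∈∁ , y∈o)
  ... | inj₂ x∈P = ≤-trans (p⊆q⇒∣p∣≤∣q∣ rest⊆D) ∣D∣≤j
    where
    rest⊆D : ∁ (R ∪ P) ∩ otherColours c x ⊆ D
    rest⊆D {y} y∈ with x∈p∩q⁻ _ _ y∈
    ... | y∈∁ , y∈o = decidable-stable (y ∈? D) λ y∉D →
      otherColours⁻ y∈o (sep x∈P (x∈∁p⇒x∉p y∈∁ ∘ p⊆p∪q P) y∉D (x∈∁p⇒x∉p y∈∁ ∘ q⊆p∪q R P))

  -- Cuts of the unpeeled vertices

  module _ (c : Fin 3) (R : Subset n) where

    module _ (D A : Subset n) where

      near far : Subset n
      near = (∁ R ∩ ∁ D) ∩ A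
      far  = (∁ R ∩ ∁ D) ∩ ∁ A

      -- Separation is expressed by edge colours rather than by the absence of walks, so that the
      -- existence of a cut can be decided by searching all pairs `D`, `A`.
      Cut : Set
      Cut = ∣ D ∣ ≤ j × Nonempty near × Nonempty far ×
            (∀ x → x ∈ near → ∀ y → y ∈ far → col f x y ≡ c)

      cut? : Dec Cut
      cut? = (∣ D ∣ ≤? j) ×-dec nonempty? near ×-dec nonempty? far ×-dec
             all? (λ x → (x ∈? near) →-dec all? λ y → (y ∈? far) →-dec (col f x y ≟ c))

      near-or-far : ∀ {x} → x ∉ R → x ∉ D → x ∈ near ⊎ x ∈ far
      near-or-far {x} x∉R x∉D with x ∈? A
      ... | yes x∈A = inj₁ (x∈p∩q⁺ (x∈p∩q⁺ (x∉p⇒x∈∁p x∉R , x∉p⇒x∈∁p x∉D) , x∈A))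
      ... | no  x∉A = inj₂ (x∈p∩q⁺ (x∈p∩q⁺ (x∉p⇒x∈∁p x∉R , x∉p⇒x∈∁p x∉D) , x∉p⇒x∈∁p x∉A))

    exists-cut? : Dec (∃₂ Cut)
    exists-cut? = anySubset? λ D → anySubset? λ A → cut? D A

    -- If deleting `D` leaves `v` unreachable from `u`, the closed set `S` found by the search
    -- serves as `A`: a crossing edge in a colour other than `c` would belong to `H` and leave `S`.
    no-cut⇒KConnected : ¬ ∃₂ Cut → 2 + j ≤ ∣ ∁ R ∣ → KConnected (suc j) (coloured f (∁ ⁅ c ⁆) (∁ R))
    no-cut⇒KConnected ¬cut large = large , connected
      where
      H = coloured f (∁ ⁅ c ⁆) (∁ R)
      connected : ∀ D → ∣ D ∣ < suc j → ConnectedOn H (∁ R ∩ ∁ D)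
      connected D ∣D∣<k u v u∈ v∈ with reach-or-closed H (∁ R ∩ ∁ D) {u} {v}
      ... | inj₁ r = r
      ... | inj₂ (S , u∈S , v∉S , closed) = contradiction
        (D , S , s≤s⁻¹ ∣D∣<k , (u , x∈p∩q⁺ (u∈ , u∈S)) , (v , x∈p∩q⁺ (v∈ , x∉p⇒x∈∁p v∉S)) , sep) ¬cut
        where
        sep : ∀ x → x ∈ near D S → ∀ y → y ∈ far D S → col f x y ≡ c
        sep x x∈ y y∈ with x∈p∩q⁻ (∁ R ∩ ∁ D) S x∈ | x∈p∩q⁻ (∁ R ∩ ∁ D) (∁ S) y∈
        ... | x∈W , x∈S | y∈W , y∈∁S = decidable-stable (col f x y ≟ c) λ xy≢c →
          closed x∈S y∈W y∉S (coloured⁺ f (∁ ⁅ c ⁆) (∁ R)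
            ( proj₁ (x∈p∩q⁻ _ _ x∈W) , proj₁ (x∈p∩q⁻ _ _ y∈W)
            , (λ { refl → y∉S x∈S }) , x∉p⇒x∈∁p (xy≢c ∘ x∈⁅y⁆⇒x≡y c)))
          where
          y∉S = x∈∁p⇒x∉p y∈∁S

    -- In colour `c` the sides `near` and `far` form a complete bipartite graph, and neither side
    -- can be deleted by `j` vertices. A remaining vertex of `R` has few edges of other colours,
    -- hence a surviving neighbour in colour `c` outside `R`.
    large-cut⇒KConnected : Peeled c R → ∣ R ∣ ≤ j → (j + j) + (j + j) < n → 2 + j ≤ n ∸ j →
                           ∀ {D A} → Cut D A → j < ∣ near D A ∣ → j < ∣ far D A ∣ →
                           KConnected (suc j) (coloured f ⁅ c ⁆ (∁ D))
    large-cut⇒KConnected peeled ∣R∣≤j 4j<n 2+j≤n∸j {D} {A} (∣D∣≤j , _ , _ , sep) j<near j<far =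
      ≤-trans 2+j≤n∸j (∣p∣≤m⇒n∸m≤∣∁p∣ D ∣D∣≤j) , connected
      where
      H = coloured f ⁅ c ⁆ (∁ D)
      connected : ∀ S → ∣ S ∣ < suc j → ConnectedOn H (∁ D ∩ ∁ S)
      connected S ∣S∣<k u v u∈ v∈ = Reach-trans (toHub u∈) (Reach-sym v∈ (toHub v∈))
        where
        W = ∁ D ∩ ∁ S
        ∣S∣≤j = s≤s⁻¹ ∣S∣<k

        near⊆∁D : near D A ⊆ ∁ D
        near⊆∁D x∈ = proj₂ (x∈p∩q⁻ (∁ R) _ (proj₁ (x∈p∩q⁻ (∁ R ∩ ∁ D) _ x∈)))
        far⊆∁D : far D A ⊆ ∁ D
        far⊆∁D x∈ = proj₂ (x∈p∩q⁻ (∁ R) _ (proj₁ (x∈p∩q⁻ (∁ R ∩ ∁ D) _ x∈)))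

        near-far : ∀ {x y} → x ∈ near D A → y ∈ far D A → Joined f ⁅ c ⁆ (∁ D) x y
        near-far {x} {y} x∈ y∈ = near⊆∁D x∈ , far⊆∁D y∈ ,
          (λ { refl → x∈∁p⇒x∉p (proj₂ (x∈p∩q⁻ (∁ R ∩ ∁ D) _ y∈)) (proj₂ (x∈p∩q⁻ (∁ R ∩ ∁ D) _ x∈)) }) ,
          subst (_∈ ⁅ c ⁆) (≡-sym (sep x x∈ y y∈)) (x∈⁅x⁆ c)

        -- The hubs `a` and `b` survive the deletion of `S`. A vertex of `far` reaches `a` by one
        -- edge, a vertex of `near` by way of `b`.
        nearHub = ∣p∣<∣q∣⇒∃ S (near D A) (≤-trans (s≤s ∣S∣≤j) j<near)
        farHub  = ∣p∣<∣q∣⇒∃ S (far D A)  (≤-trans (s≤s ∣S∣≤j) j<far)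
        a = proj₁ nearHub
        b = proj₁ farHub
        a∈near = proj₁ (proj₂ nearHub)
        b∈far  = proj₁ (proj₂ farHub)

        a∈W : a ∈ W
        a∈W = x∈p∩q⁺ (near⊆∁D a∈near , x∉p⇒x∈∁p (proj₂ (proj₂ nearHub)))
        b∈W : b ∈ W
        b∈W = x∈p∩q⁺ (far⊆∁D b∈far , x∉p⇒x∈∁p (proj₂ (proj₂ farHub)))

        edge : ∀ {x y} → Joined f ⁅ c ⁆ (∁ D) x y → E H x y ≡ true
        edge = coloured⁺ f ⁅ c ⁆ (∁ D)

        far-toHub : ∀ {x} → x ∈ far D A → Reach H W x a
        far-toHub x∈ = step (edge (joined-sym f ⁅ c ⁆ (∁ D) (near-far a∈near x∈))) a∈W here

        toHub-∉R : ∀ {x} → x ∉ R → x ∉ D → Reach H W x a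
        toHub-∉R x∉R x∉D with near-or-far D A x∉R x∉D
        ... | inj₁ x∈near = step (edge (near-far x∈near b∈far)) b∈W (far-toHub b∈far)
        ... | inj₂ x∈far  = far-toHub x∈far

        toHub : ∀ {x} → x ∈ W → Reach H W x a
        toHub {x} x∈ with x ∈? R
        ... | no x∉R  = toHub-∉R x∉R (x∈∁p⇒x∉p (proj₁ (x∈p∩q⁻ (∁ D) _ x∈)))
        ... | yes x∈R = step (edge (proj₁ (x∈p∩q⁻ (∁ D) _ x∈) , x∉p⇒x∈∁p w∉D , (λ x≡w → w∉R (subst (_∈ R) x≡w x∈R)) ,
                               subst (_∈ ⁅ c ⁆) (≡-sym xw≡c) (x∈⁅x⁆ c)))
                             (x∈p∩q⁺ (x∉p⇒x∈∁p w∉D , x∉p⇒x∈∁p w∉S)) (toHub-∉R w∉R w∉D)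
          where
          -- Four sets of at most `j` vertices each, which is why `4j < n` is assumed. A vertex
          -- outside all of them survives, is not in `R`, and is joined to `x` in colour `c`.
          avoid = (R ∪ D) ∪ (S ∪ (∁ R ∩ otherColours c x))
          ∣avoid∣≤4j : ∣ avoid ∣ ≤ (j + j) + (j + j)
          ∣avoid∣≤4j = ≤-trans (∣p∪q∣≤∣p∣+∣q∣ (R ∪ D) _) (+-mono-≤
            (≤-trans (∣p∪q∣≤∣p∣+∣q∣ R D) (+-mono-≤ ∣R∣≤j ∣D∣≤j))
            (≤-trans (∣p∪q∣≤∣p∣+∣q∣ S _) (+-mono-≤ ∣S∣≤j (peeled x∈R))))
          fresh = ∣p∣<∣q∣⇒∃ avoid ⊤ (≤-trans (s≤s ∣avoid∣≤4j) (≤-trans 4j<n (≤-reflexive (≡-sym (∣⊤∣≡n n)))))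
          w = proj₁ fresh
          w∉ = proj₂ (proj₂ fresh)
          w∉R : w ∉ R
          w∉R w∈ = w∉ (x∈p∪q⁺ (inj₁ (x∈p∪q⁺ (inj₁ w∈))))
          w∉D : w ∉ D
          w∉D w∈ = w∉ (x∈p∪q⁺ (inj₁ (x∈p∪q⁺ (inj₂ w∈))))
          w∉S : w ∉ S
          w∉S w∈ = w∉ (x∈p∪q⁺ {p = R ∪ D} (inj₂ (x∈p∪q⁺ (inj₁ w∈))))
          xw≡c : col f x w ≡ c
          xw≡c = decidable-stable (col f x w ≟ c) λ xw≢c →
            w∉ (x∈p∪q⁺ {p = R ∪ D} (inj₂ (x∈p∪q⁺ {p = S} (inj₂ (x∈p∩q⁺ (x∉p⇒x∈∁p w∉R , otherColours⁺ xw≢c))))))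

  -- The peeling recursion

  module _ (6j<n : 6 * j < n) (2+2j≤n : 2 + j + j ≤ n) (c : Fin 3) where

    private
      4j<n : (j + j) + (j + j) < n
      4j<n = ≤-trans (s≤s (≤-trans (m≤m+n _ (j + j)) (≤-reflexive
        (+-*-Solver.solve 1 (λ j → ((j :+ j) :+ (j :+ j)) :+ (j :+ j) := con 6 :* j) refl j)))) 6j<n
        where open +-*-Solver

      2+j≤n∸j : 2 + j ≤ n ∸ j
      2+j≤n∸j = m+n≤o⇒m≤o∸n (2 + j) 2+2j≤n

    -- Terminates because each round adds a nonempty set outside `R`. At the first overshoot of `j`,
    -- both `R` and the added side have at most `j` elements, which gives the size bound `j + j` of
    -- a layer.
    peel : (R : Subset n) → Acc _⊃_ R → Peeled c R → ∣ R ∣ ≤ j →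
           M≥ f 2 (suc j) (n ∸ j) ⊎ Layer c
    peel R (acc rec) peeled ∣R∣≤j with exists-cut? c R
    ... | no ¬cut = inj₁ (inj₂ (coloured f (∁ ⁅ c ⁆) (∁ R) ,
          (no-cut⇒KConnected c R ¬cut (≤-trans 2+j≤n∸j ∣∁R∣≥) ,
           ≤-trans (cf-coloured f (∁ ⁅ c ⁆) (∁ R))
             (≤-reflexive (trans (∣∁p∣≡n∸∣p∣ ⁅ c ⁆) (cong (3 ∸_) (∣⁅x⁆∣≡1 c))))) , ∣∁R∣≥))
      where
      ∣∁R∣≥ = ∣p∣≤m⇒n∸m≤∣∁p∣ R ∣R∣≤j
    ... | yes (D , A , cut@(∣D∣≤j , near≠∅ , far≠∅ , sep)) = branch
      where
      continue : (P : Subset n) → Nonempty P → P ⊆ ∁ R → ∣ P ∣ ≤ j → Peeled c (R ∪ P) →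
                 M≥ f 2 (suc j) (n ∸ j) ⊎ Layer c
      continue P (x , x∈P) P⊆∁R ∣P∣≤j peeled′ with ∣ R ∪ P ∣ ≤? j
      ... | yes small = peel (R ∪ P) (rec (p⊆p∪q P , x , q⊆p∪q R P x∈P , x∈∁p⇒x∉p (P⊆∁R x∈P))) peeled′ small
      ... | no ¬small = inj₂ (R ∪ P , peeled′ , ≰⇒> ¬small ,
              ≤-trans (∣p∪q∣≤∣p∣+∣q∣ R P) (+-mono-≤ ∣R∣≤j ∣P∣≤j))

      sep-near : ∀ {x y} → x ∈ near c R D A → y ∉ R → y ∉ D → y ∉ near c R D A → col f x y ≡ c
      sep-near x∈ y∉R y∉D y∉near with near-or-far c R D A y∉R y∉D
      ... | inj₁ y∈near = contradiction y∈near y∉near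
      ... | inj₂ y∈far  = sep _ x∈ _ y∈far

      sep-far : ∀ {x y} → x ∈ far c R D A → y ∉ R → y ∉ D → y ∉ far c R D A → col f x y ≡ c
      sep-far {x} {y} x∈ y∉R y∉D y∉far with near-or-far c R D A y∉R y∉D
      ... | inj₁ y∈near = trans (sym f x y) (sep _ y∈near _ x∈)
      ... | inj₂ y∈far  = contradiction y∈far y∉far

      branch : M≥ f 2 (suc j) (n ∸ j) ⊎ Layer c
      branch with ∣ near c R D A ∣ ≤? j | ∣ far c R D A ∣ ≤? j
      -- Any side with at most `j` vertices may be peeled off; `near` is tried first.
      ... | yes small | _         = continue (near c R D A) near≠∅ (p∩q⊆p _ _ ∘ p∩q⊆p _ _) small (peeled-∪ peeled ∣D∣≤j sep-near)
      ... | no _      | yes small = continue (far c R D A)  far≠∅  (p∩q⊆p _ _ ∘ p∩q⊆p _ _) small (peeled-∪ peeled ∣D∣≤j sep-far)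
      ... | no ¬near  | no ¬far   = inj₁ (inj₂ (coloured f ⁅ c ⁆ (∁ D) ,
            (large-cut⇒KConnected c R peeled ∣R∣≤j 4j<n 2+j≤n∸j cut (≰⇒> ¬near) (≰⇒> ¬far) ,
             ≤-trans (cf-coloured f ⁅ c ⁆ (∁ D)) (≤-trans (≤-reflexive (∣⁅x⁆∣≡1 c)) (s≤s z≤n))) ,
            ∣p∣≤m⇒n∸m≤∣∁p∣ D ∣D∣≤j))

    peeled-or-connected : M≥ f 2 (suc j) (n ∸ j) ⊎ Layer c
    peeled-or-connected = peel ⊥ (⊃-wellFounded _) (λ x∈⊥ → contradiction x∈⊥ ∉⊥) (≤-trans (≤-reflexive (∣⊥∣≡0 n)) z≤n)

  -- Disjointness and incompatibility of layers

  peeled-disjoint : ∀ {c d P Q} → c ≢ d → 6 * j < n → Peeled c P → ∣ P ∣ ≤ j + j → Peeled d Q → ∣ Q ∣ ≤ j + j → Disjoint P Q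
  peeled-disjoint {c} {d} {P} {Q} c≢d 6j<n peeledP ∣P∣≤2j peeledQ ∣Q∣≤2j {x} x∈P x∈Q =
    contradiction n≤6j (<⇒≱ 6j<n)
    where
    -- For a common vertex `x`, no `y` has `col f x y` equal to both `c` and `d`. So each `y` lies
    -- in `P`, in `Q`, or in one of the two off-colour neighbourhoods of `x`, altogether at most
    -- `2 * (2j + j)` vertices.
    cover = (P ∪ (∁ P ∩ otherColours c x)) ∪ (Q ∪ (∁ Q ∩ otherColours d x))
    ⊤⊆cover : ⊤ ⊆ cover
    ⊤⊆cover {y} _ with y ∈? P | y ∈? Q | col f x y ≟ c
    ... | yes y∈P | _       | _       = x∈p∪q⁺ (inj₁ (x∈p∪q⁺ (inj₁ y∈P)))
    ... | no _    | yes y∈Q | _       = x∈p∪q⁺ {p = P ∪ _} (inj₂ (x∈p∪q⁺ (inj₁ y∈Q)))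
    ... | no y∉P  | no y∉Q  | no xy≢c = x∈p∪q⁺ (inj₁ (x∈p∪q⁺ {p = P} (inj₂ (x∈p∩q⁺ (x∉p⇒x∈∁p y∉P , otherColours⁺ xy≢c)))))
    ... | no y∉P  | no y∉Q  | yes refl = x∈p∪q⁺ {p = P ∪ _} (inj₂ (x∈p∪q⁺ {p = Q} (inj₂ (x∈p∩q⁺ (x∉p⇒x∈∁p y∉Q , otherColours⁺ c≢d)))))
    n≤6j : n ≤ 6 * j
    n≤6j = begin
      n                                   ≡⟨ ∣⊤∣≡n n ⟨
      ∣ ⊤ {n} ∣                           ≤⟨ p⊆q⇒∣p∣≤∣q∣ ⊤⊆cover ⟩
      ∣ cover ∣                           ≤⟨ ∣p∪q∣≤∣p∣+∣q∣ (P ∪ _) _ ⟩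
      ∣ P ∪ (∁ P ∩ otherColours c x) ∣ + ∣ Q ∪ (∁ Q ∩ otherColours d x) ∣
        ≤⟨ +-mono-≤ (≤-trans (∣p∪q∣≤∣p∣+∣q∣ P _) (+-mono-≤ ∣P∣≤2j (peeledP x∈P)))
                    (≤-trans (∣p∪q∣≤∣p∣+∣q∣ Q _) (+-mono-≤ ∣Q∣≤2j (peeledQ x∈Q))) ⟩
      ((j + j) + j) + ((j + j) + j)       ≡⟨ solve 1 (λ j → ((j :+ j) :+ j) :+ ((j :+ j) :+ j) := con 6 :* j) refl j ⟩
      6 * j                               ∎
      where
      open ≤-Reasoning
      open +-*-Solver

  -- Counts the pairs of `P × Q` whose colour is not `c`, grouped by their end in `P`.
  offColour : Fin 3 → Subset n → Subset n → ℕ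
  offColour c P Q = sum λ x → indicator P x * ∣ Q ∩ otherColours c x ∣

  -- A pair whose colour is not `c` is counted from the side of `P`; one of colour `c` is not of
  -- colour `d` and is counted from the side of `Q`, by symmetry of `col`.
  ∣P∣*∣Q∣≤offColour : ∀ {c d} P Q → c ≢ d → ∣ P ∣ * ∣ Q ∣ ≤ offColour c P Q + offColour d Q P
  ∣P∣*∣Q∣≤offColour {c} {d} P Q c≢d = begin
    ∣ P ∣ * ∣ Q ∣                                          ≡⟨ cong (_* ∣ Q ∣) (∣p∣≡∑indicator P) ⟩
    sum (indicator P) * ∣ Q ∣                              ≡⟨ *-distribʳ-sum ∣ Q ∣ (indicator P) ⟩
    sum (λ x → indicator P x * ∣ Q ∣)                      ≡⟨ sum-cong-≗ (λ x → expand (indicator P x) Q) ⟩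
    sum (λ x → sum (λ y → indicator P x * indicator Q y))  ≤⟨ ∑-mono-≤ _ _ (λ x → ∑-mono-≤ _ _ (pointwise x)) ⟩
    sum (λ x → sum (λ y → F x y + G y x))                  ≡⟨ sum-cong-≗ (λ x → ∑-distrib-+ (F x) (λ y → G y x)) ⟩
    sum (λ x → sum (F x) + sum (λ y → G y x))              ≡⟨ ∑-distrib-+ (λ x → sum (F x)) _ ⟩
    sum (λ x → sum (F x)) + sum (λ x → sum (λ y → G y x))  ≡⟨ cong (sum (λ x → sum (F x)) +_) (∑-comm (λ x y → G y x)) ⟩
    sum (λ x → sum (F x)) + sum (λ y → sum (G y))          ≡⟨ cong₂ _+_ (sum-cong-≗ λ x → expand (indicator P x) (Q ∩ otherColours c x)) (sum-cong-≗ λ y → expand (indicator Q y) (P ∩ otherColours d y)) ⟨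
    offColour c P Q + offColour d Q P                      ∎
    where
    open ≤-Reasoning
    F G : Fin n → Fin n → ℕ
    F x y = indicator P x * indicator (Q ∩ otherColours c x) y
    G y x = indicator Q y * indicator (P ∩ otherColours d y) x
    expand : ∀ a (S : Subset n) → a * ∣ S ∣ ≡ sum (λ y → a * indicator S y)
    expand a S = trans (cong (a *_) (∣p∣≡∑indicator S)) (*-distribˡ-sum a (indicator S))
    pointwise : ∀ x y → indicator P x * indicator Q y ≤ F x y + G y x
    pointwise x y with x ∈? P | y ∈? Q | col f x y ≟ c
    ... | no x∉P  | _       | _ rewrite indicator-∉ P x∉P = z≤n
    ... | yes x∈P | no y∉Q  | _ rewrite indicator-∉ Q y∉Q | *-zeroʳ (indicator P x) = z≤n
    ... | yes x∈P | yes y∈Q | no xy≢c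
      rewrite indicator-∈ P x∈P | indicator-∈ Q y∈Q
            | indicator-∈ (Q ∩ otherColours c x) (x∈p∩q⁺ (y∈Q , otherColours⁺ xy≢c)) = s≤s z≤n
    ... | yes x∈P | yes y∈Q | yes xy≡c
      rewrite indicator-∈ P x∈P | indicator-∈ Q y∈Q
            | indicator-∈ (P ∩ otherColours d y) (x∈p∩q⁺ (x∈P , otherColours⁺ λ yx≡d → c≢d (trans (≡-sym xy≡c) (trans (sym f x y) yx≡d))))
            = m≤n+m 1 _

  -- The off-colour neighbours of `x ∈ P` in `Q` and in `Q′` are disjoint sets outside `P`, so one
  -- bound `j` covers both together.
  offColour-bound : ∀ {c P Q Q′} → Peeled c P → Disjoint P Q → Disjoint P Q′ → Disjoint Q Q′ →
                    offColour c P Q + offColour c P Q′ ≤ ∣ P ∣ * j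
  offColour-bound {c} {P} {Q} {Q′} peeled P∥Q P∥Q′ Q∥Q′ = begin
    offColour c P Q + offColour c P Q′     ≡⟨ ∑-distrib-+ (λ x → indicator P x * ∣ Q ∩ o x ∣) _ ⟨
    sum (λ x → indicator P x * ∣ Q ∩ o x ∣ + indicator P x * ∣ Q′ ∩ o x ∣)
                                           ≤⟨ ∑-mono-≤ _ _ pointwise ⟩
    sum (λ x → indicator P x * j)          ≡⟨ *-distribʳ-sum j (indicator P) ⟨
    sum (indicator P) * j                  ≡⟨ cong (_* j) (∣p∣≡∑indicator P) ⟨
    ∣ P ∣ * j                              ∎
    where
    open ≤-Reasoning
    o = otherColours c
    ∪⊆ : ∀ {x} → (Q ∩ o x) ∪ (Q′ ∩ o x) ⊆ ∁ P ∩ o x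
    ∪⊆ {x} y∈ with x∈p∪q⁻ (Q ∩ o x) _ y∈
    ... | inj₁ y∈Q  = let y∈ , y∈o = x∈p∩q⁻ Q  _ y∈Q  in x∈p∩q⁺ (x∉p⇒x∈∁p (λ y∈P → P∥Q  y∈P y∈) , y∈o)
    ... | inj₂ y∈Q′ = let y∈ , y∈o = x∈p∩q⁻ Q′ _ y∈Q′ in x∈p∩q⁺ (x∉p⇒x∈∁p (λ y∈P → P∥Q′ y∈P y∈) , y∈o)
    pointwise : ∀ x → indicator P x * ∣ Q ∩ o x ∣ + indicator P x * ∣ Q′ ∩ o x ∣ ≤ indicator P x * j
    pointwise x with x ∈? P
    ... | no x∉P rewrite indicator-∉ P x∉P = z≤n
    ... | yes x∈P = ≤-trans (≤-reflexive (≡-sym (*-distribˡ-+ (indicator P x) _ _)))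
      (*-monoʳ-≤ (indicator P x) (≤-trans
        (disjoint⇒∣p∣+∣q∣≤∣p∪q∣ (Q ∩ o x) (Q′ ∩ o x) λ y∈Q y∈Q′ → Q∥Q′ (p∩q⊆p _ _ y∈Q) (p∩q⊆p _ _ y∈Q′))
        (≤-trans (p⊆q⇒∣p∣≤∣q∣ ∪⊆) (peeled x∈P))))

  layers-incompatible : 6 * j < n → Layer 0F → Layer 1F → ¬ Layer 2F
  layers-incompatible 6j<n (P₀ , pl₀ , lo₀ , hi₀) (P₁ , pl₁ , lo₁ , hi₁) (P₂ , pl₂ , lo₂ , hi₂) = <-irrefl refl (begin-strict
    a * j + b * j + c * j                          ≡⟨ solve 4 (λ a b c j → a :* j :+ b :* j :+ c :* j := (a :+ b :+ c) :* j) refl a b c j ⟩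
    -- Strict because `j < a` makes `a + b + c` positive.
    (a + b + c) * j                                <⟨ m<n+m _ (≤-trans (≤-trans (s≤s z≤n) lo₀) (≤-trans (m≤m+n a b) (m≤m+n (a + b) c))) ⟩
    (a + b + c) + (a + b + c) * j                  ≡⟨ solve 4 (λ a b c j → (a :+ b :+ c) :+ (a :+ b :+ c) :* j := a :* (con 1 :+ j) :+ b :* (con 1 :+ j) :+ c :* (con 1 :+ j)) refl a b c j ⟩
    a * suc j + b * suc j + c * suc j              ≤⟨ +-mono-≤ (+-mono-≤ (*-monoʳ-≤ a lo₁) (*-monoʳ-≤ b lo₂)) (*-monoʳ-≤ c lo₀) ⟩
    a * b + b * c + c * a
      ≤⟨ +-mono-≤ (+-mono-≤ (∣P∣*∣Q∣≤offColour P₀ P₁ (λ ())) (∣P∣*∣Q∣≤offColour P₁ P₂ (λ ()))) (∣P∣*∣Q∣≤offColour P₂ P₀ (λ ())) ⟩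
    (s₀₁ + s₁₀) + (s₁₂ + s₂₁) + (s₂₀ + s₀₂)
      -- Regroups the six counts by the layer they are counted from, so that each layer's peeling
      -- bound applies to its two counts at once.
      ≡⟨ solve 6 (λ s₀₁ s₁₀ s₁₂ s₂₁ s₂₀ s₀₂ → (s₀₁ :+ s₁₀) :+ (s₁₂ :+ s₂₁) :+ (s₂₀ :+ s₀₂) := (s₀₁ :+ s₀₂) :+ (s₁₂ :+ s₁₀) :+ (s₂₀ :+ s₂₁)) refl s₀₁ s₁₀ s₁₂ s₂₁ s₂₀ s₀₂ ⟩
    (s₀₁ + s₀₂) + (s₁₂ + s₁₀) + (s₂₀ + s₂₁)
      ≤⟨ +-mono-≤ (+-mono-≤ (offColour-bound pl₀ ∥₀₁ (flip∥ ∥₂₀) ∥₁₂) (offColour-bound pl₁ ∥₁₂ (flip∥ ∥₀₁) ∥₂₀)) (offColour-bound pl₂ ∥₂₀ (flip∥ ∥₁₂) ∥₀₁) ⟩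
    a * j + b * j + c * j                          ∎)
    where
    open ≤-Reasoning
    open +-*-Solver
    a = ∣ P₀ ∣
    b = ∣ P₁ ∣
    c = ∣ P₂ ∣
    s₀₁ = offColour 0F P₀ P₁
    s₁₀ = offColour 1F P₁ P₀
    s₁₂ = offColour 1F P₁ P₂
    s₂₁ = offColour 2F P₂ P₁
    s₂₀ = offColour 2F P₂ P₀
    s₀₂ = offColour 0F P₀ P₂
    flip∥ : ∀ {p q : Subset n} → Disjoint p q → Disjoint q p
    flip∥ p∥q x∈q x∈p = p∥q x∈p x∈q
    ∥₀₁ : Disjoint P₀ P₁
    ∥₀₁ = peeled-disjoint (λ ()) 6j<n pl₀ hi₀ pl₁ hi₁
    ∥₁₂ : Disjoint P₁ P₂
    ∥₁₂ = peeled-disjoint (λ ()) 6j<n pl₁ hi₁ pl₂ hi₂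
    ∥₂₀ : Disjoint P₂ P₀
    ∥₂₀ = peeled-disjoint (λ ()) 6j<n pl₂ hi₂ pl₀ hi₀

  lower-bound : 6 * j < n → 2 + j + j ≤ n → M≥ f 2 (suc j) (n ∸ j)
  lower-bound 6j<n 2+2j≤n
    with peeled-or-connected 6j<n 2+2j≤n 0F | peeled-or-connected 6j<n 2+2j≤n 1F | peeled-or-connected 6j<n 2+2j≤n 2F
  ... | inj₁ big | _        | _        = big
  ... | inj₂ _   | inj₁ big | _        = big
  ... | inj₂ _   | inj₂ _   | inj₁ big = big
  ... | inj₂ l₀  | inj₂ l₁  | inj₂ l₂  = contradiction l₂ (layers-incompatible 6j<n l₀ l₁)

-- Upper bound

-- Label 3F marks the vertices outside A₀ ∪ A₁ ∪ A₂.
labelColour : Fin 4 → Fin 4 → Fin 3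
labelColour 0F 2F = 2F
labelColour 2F 0F = 2F
labelColour 0F _  = 0F
labelColour _  0F = 0F
labelColour 1F _  = 1F
labelColour _  1F = 1F
labelColour 2F _  = 2F
labelColour _  2F = 2F
labelColour 3F 3F = 0F

labelColour-sym : ∀ s t → labelColour s t ≡ labelColour t s
labelColour-sym 0F 0F = refl
labelColour-sym 0F 1F = refl
labelColour-sym 0F 2F = refl
labelColour-sym 0F 3F = refl
labelColour-sym 1F 0F = refl
labelColour-sym 1F 1F = refl
labelColour-sym 1F 2F = refl
labelColour-sym 1F 3F = refl
labelColour-sym 2F 0F = refl
labelColour-sym 2F 1F = refl
labelColour-sym 2F 2F = refl
labelColour-sym 2F 3F = refl
labelColour-sym 3F 0F = refl
labelColour-sym 3F 1F = refl
labelColour-sym 3F 2F = refl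
labelColour-sym 3F 3F = refl

cyclicPred : Fin 3 → Fin 3
cyclicPred 0F = 2F
cyclicPred 1F = 0F
cyclicPred 2F = 1F

inject₁≢cyclicPred : ∀ c → inject₁ c ≢ inject₁ (cyclicPred c)
inject₁≢cyclicPred 0F ()
inject₁≢cyclicPred 1F ()
inject₁≢cyclicPred 2F ()

labelColour≢ : ∀ c t → labelColour (inject₁ c) t ≢ c → t ≡ inject₁ (cyclicPred c)
labelColour≢ 0F 0F ≢c = contradiction refl ≢c
labelColour≢ 0F 1F ≢c = contradiction refl ≢c
labelColour≢ 0F 2F ≢c = refl
labelColour≢ 0F 3F ≢c = contradiction refl ≢c
labelColour≢ 1F 0F ≢c = refl
labelColour≢ 1F 1F ≢c = contradiction refl ≢c
labelColour≢ 1F 2F ≢c = contradiction refl ≢c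
labelColour≢ 1F 3F ≢c = contradiction refl ≢c
labelColour≢ 2F 0F ≢c = contradiction refl ≢c
labelColour≢ 2F 1F ≢c = refl
labelColour≢ 2F 2F ≢c = contradiction refl ≢c
labelColour≢ 2F 3F ≢c = contradiction refl ≢c

-- Colourings induced by vertex labels

module _ (L : Vec (Fin 4) n) where

  labelColouring : Colouring n 3
  labelColouring = record
    { col = λ u v → labelColour (lookup L u) (lookup L v)
    ; sym = λ u v → labelColour-sym (lookup L u) (lookup L v)
    }

  labelClass : Fin 4 → Subset n
  labelClass t = map (λ s → does (s ≟ t)) L

  labelClass⁺ : ∀ {t x} → lookup L x ≡ t → x ∈ labelClass t
  labelClass⁺ {t} {x} eq = lookup⇒[]= x _ (trans (lookup-map x _ L) (dec-true (lookup L x ≟ t) eq))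

  labelClass⁻ : ∀ {t x} → x ∈ labelClass t → lookup L x ≡ t
  labelClass⁻ {t} {x} x∈ = does⁻ (lookup L x ≟ t) (trans (≡-sym (lookup-map x _ L)) ([]=⇒lookup x∈))

  -- Deleting the preceding class `D`, of fewer than `k` vertices, isolates a vertex `x` of class
  -- `c`: its edges in `H` avoid colour `c` and so lead into `D`. But `H` has at least `j + 2`
  -- vertices, hence another one, `w`, outside `D`.
  KConnected-avoids-class : ∀ {c} H → KConnected (suc j) H → c ∉ usedColours labelColouring H →
    ∣ labelClass (inject₁ (cyclicPred c)) ∣ ≤ j → V H ⊆ ∁ (labelClass (inject₁ c))
  KConnected-avoids-class {j} {c} H (k<∣V∣ , connected) c∉ ∣D∣≤j {x} x∈V = x∉p⇒x∈∁p absurd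
    where
    D = labelClass (inject₁ (cyclicPred c))
    absurd : x ∉ labelClass (inject₁ c)
    absurd x∈c = stuck (connected D (s≤s ∣D∣≤j) x w
      (x∈p∩q⁺ (x∈V , x∉p⇒x∈∁p λ x∈D → inject₁≢cyclicPred c (trans (≡-sym (labelClass⁻ x∈c)) (labelClass⁻ x∈D))))
      (x∈p∩q⁺ (w∈V , x∉p⇒x∈∁p (w∉ ∘ p⊆p∪q ⁅ x ⁆))))
      where
      small : ∣ D ∪ ⁅ x ⁆ ∣ < ∣ V H ∣
      small = ≤-trans (s≤s (≤-trans (∣p∪q∣≤∣p∣+∣q∣ D ⁅ x ⁆) (≤-trans (+-mono-≤ ∣D∣≤j (≤-reflexive (∣⁅x⁆∣≡1 x))) (≤-reflexive (+-comm j 1))))) k<∣V∣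
      other = ∣p∣<∣q∣⇒∃ (D ∪ ⁅ x ⁆) (V H) small
      w = proj₁ other
      w∈V = proj₁ (proj₂ other)
      w∉ = proj₂ (proj₂ other)
      -- The endpoint is left variable so that `here` can be matched; only the first step of the
      -- walk matters.
      stuck′ : ∀ {y} → Reach H (V H ∩ ∁ D) x y → ¬ x ≢ y
      stuck′ here x≢y = x≢y refl
      stuck′ (step {v = y} xy y∈ _) _ = x∈∁p⇒x∉p (proj₂ (x∈p∩q⁻ (V H) _ y∈))
        (labelClass⁺ (labelColour≢ c (lookup L y) λ eq →
          c∉ (subst (_∈ usedColours labelColouring H)
            (trans (cong (λ s → labelColour s (lookup L y)) (labelClass⁻ x∈c)) eq)
            (usedColours⁺ labelColouring H x y xy))))
      stuck : ¬ Reach H (V H ∩ ∁ D) x w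
      stuck r = stuck′ r λ x≡w → w∉ (x∈p∪q⁺ {p = D} (inj₂ (subst (_∈ ⁅ x ⁆) x≡w (x∈⁅x⁆ x))))

  labelColouring-M≤ : (∀ c → ∣ labelClass (inject₁ c) ∣ ≡ j) → M≤ labelColouring 2 (suc j) (n ∸ j)
  labelColouring-M≤ {j} size H (kconn , cf≤2) with missingColour (usedColours labelColouring H) cf≤2
  ... | c , c∉ = ≤-trans
    (p⊆q⇒∣p∣≤∣q∣ (KConnected-avoids-class H kconn c∉ (≤-reflexive (size (cyclicPred c)))))
    (≤-reflexive (trans (∣∁p∣≡n∸∣p∣ (labelClass (inject₁ c))) (cong (n ∸_) (size c))))

-- Three blocks of equal size

blockLabels : ∀ j r → Vec (Fin 4) (j + (j + (j + r)))
blockLabels j r = replicate j 0F ++ replicate j 1F ++ replicate j 2F ++ replicate r 3F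

∣labelClass-++∣ : ∀ t (xs : Vec (Fin 4) m) (ys : Vec (Fin 4) n) →
                  ∣ labelClass (xs ++ ys) t ∣ ≡ ∣ labelClass xs t ∣ + ∣ labelClass ys t ∣
∣labelClass-++∣ t xs ys = trans (cong ∣_∣ (map-++ _ xs ys)) (∣p++q∣≡∣p∣+∣q∣ (labelClass xs t) _)

∣labelClass-replicate∣ : ∀ t s m → ∣ labelClass (replicate m s) t ∣ ≡ (if does (s ≟ t) then m else 0)
∣labelClass-replicate∣ t s m = trans (cong ∣_∣ (map-replicate _ s m)) (size (does (s ≟ t)))
  where
  size : ∀ b → ∣ replicate m b ∣ ≡ (if b then m else 0)
  size true  = ∣⊤∣≡n m
  size false = ∣⊥∣≡0 m

∣labelClass-blockLabels∣ : ∀ j r c → ∣ labelClass (blockLabels j r) (inject₁ c) ∣ ≡ j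
∣labelClass-blockLabels∣ j r c
  rewrite ∣labelClass-++∣ (inject₁ c) (replicate j 0F) (replicate j 1F ++ replicate j 2F ++ replicate r 3F)
        | ∣labelClass-++∣ (inject₁ c) (replicate j 1F) (replicate j 2F ++ replicate r 3F)
        | ∣labelClass-++∣ (inject₁ c) (replicate j 2F) (replicate r 3F)
        | ∣labelClass-replicate∣ (inject₁ c) 0F j
        | ∣labelClass-replicate∣ (inject₁ c) 1F j
        | ∣labelClass-replicate∣ (inject₁ c) 2F j
        | ∣labelClass-replicate∣ (inject₁ c) 3F r
  with c
... | 0F = +-identityʳ j
... | 1F = +-identityʳ j
... | 2F = +-identityʳ j

upper-bound : ∀ n j → 3 * j ≤ n → ∃ λ (f : Colouring n 3) → M≤ f 2 (suc j) (n ∸ j)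
upper-bound n j 3j≤n with m≤n⇒∃[o]m+o≡n 3j≤n
-- The `r` vertices beyond the three blocks receive label `3F`.
... | r , refl = subst (λ n → ∃ λ (f : Colouring n 3) → M≤ f 2 (suc j) (n ∸ j))
  (solve 2 (λ j r → j :+ (j :+ (j :+ r)) := con 3 :* j :+ r) refl j r)
  (labelColouring L , labelColouring-M≤ L (∣labelClass-blockLabels∣ j r))
  where
  open +-*-Solver
  L = blockLabels j r

-- Numerical thresholds

13k≤n+15⇒6j<n : ∀ n j → 2 ≤ n → 13 * suc j ≤ n + 15 → 6 * j < n
13k≤n+15⇒6j<n n zero    2≤n _ = ≤-trans (s≤s z≤n) 2≤n
-- With `j = suc i`, the slack `4 + 7 * i` is the difference between `13 * suc j` and
-- `suc (6 * j) + 15`.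
13k≤n+15⇒6j<n n (suc i) 2≤n h = +-cancelʳ-≤ 15 _ _ (≤-trans
  (≤-trans (m≤m+n _ (4 + 7 * i))
    (≤-reflexive (solve 1 (λ i → (con 1 :+ con 6 :* (con 1 :+ i)) :+ con 15 :+ (con 4 :+ con 7 :* i) := con 13 :* (con 2 :+ i)) refl i))) h)
  where open +-*-Solver

6j<n⇒2+2j≤n : ∀ n j → 2 ≤ n → 6 * j < n → 2 + j + j ≤ n
-- Here `6 * j < n` only gives `1 ≤ n`, so the bound comes from `2 ≤ n`.
6j<n⇒2+2j≤n n zero    2≤n _    = 2≤n
6j<n⇒2+2j≤n n (suc i) _   6j<n = ≤-trans
  (≤-trans (m≤m+n _ (3 + 4 * i))
    (≤-reflexive (solve 1 (λ i → con 2 :+ (con 1 :+ i) :+ (con 1 :+ i) :+ (con 3 :+ con 4 :* i) := con 1 :+ con 6 :* (con 1 :+ i)) refl i))) 6j<n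
  where open +-*-Solver

theorem1p2 : (n k : ℕ) → 1 ≤ k → 2 ≤ n → 13 * k ≤ n + 15 →
    m≡ n 3 2 k (n ∸ k + 1)
theorem1p2 n (suc j) _ 2≤n 13k≤n+15 = subst (m≡ n 3 2 (suc j)) n∸j≡
  ( (λ f → lower-bound f j 6j<n (6j<n⇒2+2j≤n n j 2≤n 6j<n))
  , upper-bound n j (≤-trans (*-monoˡ-≤ j {3} {6} (s≤s (s≤s (s≤s z≤n)))) (<⇒≤ 6j<n)))
  where
  6j<n : 6 * j < n
  6j<n = 13k≤n+15⇒6j<n n j 2≤n 13k≤n+15
  n∸j≡ : n ∸ j ≡ n ∸ suc j + 1
  -- `n ∸ j` is `suc n ∸ suc j` by definition; pulling the successor out of the truncated
  -- subtraction requires `suc j ≤ n`.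
  n∸j≡ = trans (+-∸-assoc 1 (≤-trans (s≤s (m≤m+n j (5 * j))) 6j<n)) (+-comm 1 (n ∸ suc j))
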